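{- For every $q\geq 2$, $$k_{\min}(K_{1,q})=\lceil\log_2 q\rceil+1 .$$ In particular $k_{\min}(K_{1,4})=3<4=n-1=\mathrm{idim}(K_{1,4})$ (where $n=5$ is the number of vertices), and stars realize an exponential gap between $k_{\min}$ and both the dimension $n-1$ and the isometric dimension $\mathrm{idim}$.
   Context: $K_{1,q}$ is the star with $q$ leaves. For a generating set $S\subseteq\mathbb{Z}_2^k\setminus\{0\}$, $\mathrm{Cay}(\mathbb{Z}_2^k,S)$ is the graph on $\mathbb{Z}_2^k$ with edges $\{g,g+s\}$, $s\in S$. $k_{\min}(G)$ is the least $k$ such that the finite connected graph $G$ embeds isometrically (preserving shortest-path distances) into $\mathrm{Cay}(\mathbb{Z}_2^k,S)$ for some such $S$. $\mathrm{idim}(G)$ is the least $k$ such that $G$ embeds isometrically into the hypercube $Q_k=\mathrm{Cay}(\mathbb{Z}_2^k,\{e_1,\dots,e_k\})$. -}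

module Defs where

open import Data.Bool using (Bool; true; false; _xor_)
open import Data.Bool.Properties
  using (xor-assoc; xor-same; xor-identityˡ; xor-identityʳ)
import Data.Bool.Properties as Bool
open import Data.Fin using (Fin; zero; suc)
open import Data.Fin.Properties using (any?)
open import Data.Nat using (ℕ; zero; suc; _≤_)
open import Data.Nat.Properties using (≤-antisym)
open import Data.Product using (Σ; ∃-syntax; _×_; _,_)
open import Data.Vec using (Vec; []; _∷_; tail; replicate; zipWith; _[_]≔_)
open import Data.Vec.Properties
  using (≡-dec; zipWith-assoc; zipWith-identityʳ; zipWith-identityˡ)
open import Function using (_⇔_)
open import Level using (Level; 0ℓ)
open import Relation.Binary.Core using (Rel)
import Relation.Binary.Definitions as Binary
open import Relation.Binary.PropositionalEquality
  using (_≡_; refl; sym; trans; cong; cong₂; subst)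
open import Relation.Nullary using (¬_; yes; no)
open import Relation.Unary using (Pred; Decidable; _∈_; _∉_)

IsLeast : {ℓ : Level} → Pred ℕ ℓ → Pred ℕ ℓ
IsLeast P m = P m × (∀ j → P j → m ≤ j)

IsLeast-unique : {ℓ : Level} {P : Pred ℕ ℓ} {m n : ℕ} →
                 IsLeast P m → IsLeast P n → m ≡ n
IsLeast-unique (pm , lm) (pn , ln) = ≤-antisym (lm _ pn) (ln _ pm)

record Graph : Set₁ where
  field
    Vertex : Set
    Adj    : Rel Vertex 0ℓ
    symm   : ∀ {u v} → Adj u v → Adj v u
    irrefl : ∀ {v} → ¬ Adj v v

module _ (G : Graph) where
  open Graph G

  data Walk : Vertex → Vertex → ℕ → Set where
    stop : ∀ {v} → Walk v v zero
    step : ∀ {u v w n} → Adj u v → Walk v w n → Walk u w (suc n)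

  Connected : Set
  Connected = ∀ u v → ∃[ n ] Walk u v n

  -- The shortest-path distance is kept as a relation, because computing it
  -- would need extra hypotheses on the graph.
  IsDist : Vertex → Vertex → Pred ℕ 0ℓ
  IsDist u v = IsLeast (Walk u v)

record IsometricEmbedding (G H : Graph) : Set where
  private
    module G = Graph G
    module H = Graph H
  field
    map       : G.Vertex → H.Vertex
    preserves : ∀ u v d → IsDist G u v d ⇔ IsDist H (map u) (map v) d

record FiniteConnectedGraph : Set₁ where
  field
    order     : ℕ
    Adj       : Rel (Fin order) 0ℓ
    adj?      : Binary.Decidable Adj
    symm      : ∀ {u v} → Adj u v → Adj v u
    irrefl    : ∀ {v} → ¬ Adj v v

  graph : Graph
  graph = record { Vertex = Fin order ; Adj = Adj ; symm = symm ; irrefl = irrefl }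

  field
    connected : Connected graph

Z₂^ : ℕ → Set
Z₂^ k = Vec Bool k

infixl 6 _⊕_

_⊕_ : {k : ℕ} → Z₂^ k → Z₂^ k → Z₂^ k
_⊕_ = zipWith _xor_

𝟘 : {k : ℕ} → Z₂^ k
𝟘 = replicate _ false

⊕-same : {k : ℕ} (x : Z₂^ k) → x ⊕ x ≡ 𝟘
⊕-same []       = refl
⊕-same (b ∷ x) = cong₂ _∷_ (xor-same b) (⊕-same x)

⊕-identityʳ : {k : ℕ} (x : Z₂^ k) → x ⊕ 𝟘 ≡ x
⊕-identityʳ = zipWith-identityʳ xor-identityʳ

⊕-identityˡ : {k : ℕ} (x : Z₂^ k) → 𝟘 ⊕ x ≡ x
⊕-identityˡ = zipWith-identityˡ xor-identityˡ

⊕-assoc : {k : ℕ} (x y z : Z₂^ k) → (x ⊕ y) ⊕ z ≡ x ⊕ (y ⊕ z)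
⊕-assoc = zipWith-assoc xor-assoc

-- The subgroup generated by S; closure under inverses is automatic, since
-- every element is its own inverse.
data ⟨_⟩ {k : ℕ} (S : Pred (Z₂^ k) 0ℓ) : Pred (Z₂^ k) 0ℓ where
  gen : ∀ {s} → s ∈ S → s ∈ ⟨ S ⟩
  nil : 𝟘 ∈ ⟨ S ⟩
  add : ∀ {x y} → x ∈ ⟨ S ⟩ → y ∈ ⟨ S ⟩ → x ⊕ y ∈ ⟨ S ⟩

record GeneratingSet (k : ℕ) : Set₁ where
  field
    member    : Pred (Z₂^ k) 0ℓ
    member?   : Decidable member
    0∉        : 𝟘 ∉ member
    generates : ∀ g → g ∈ ⟨ member ⟩

Cay : (k : ℕ) → GeneratingSet k → Graph
Cay k S = record
  { Vertex = Z₂^ k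
  ; Adj    = λ g h → ∃[ s ] (s ∈ member × h ≡ g ⊕ s)
  ; symm   = λ { {g} (s , s∈ , refl) → s , s∈ , sym (cancel g s) }
  ; irrefl = λ { {g} (s , s∈ , eq) → 0∉ (subst (_∈ member) (is-zero g s eq) s∈) }
  }
  where
  open GeneratingSet S

  cancel : ∀ g s → (g ⊕ s) ⊕ s ≡ g
  cancel g s = trans (⊕-assoc g s s) (trans (cong (g ⊕_) (⊕-same s)) (⊕-identityʳ g))

  is-zero : ∀ g s → g ≡ g ⊕ s → s ≡ 𝟘
  is-zero g s eq = trans (sym (⊕-identityˡ s))
    (trans (cong (_⊕ s) (sym (⊕-same g)))
    (trans (⊕-assoc g g s)
    (trans (cong (g ⊕_) (sym eq)) (⊕-same g))))

e : {k : ℕ} → Fin k → Z₂^ k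
e i = 𝟘 [ i ]≔ true

standardBasis : (k : ℕ) → GeneratingSet k
standardBasis k = record
  { member    = Basis
  ; member?   = λ x → any? (λ i → ≡-dec Bool._≟_ x (e i))
  ; 0∉        = λ (i , eq) → 𝟘≢e i eq
  ; generates = spans
  }
  where
  Basis : {n : ℕ} → Pred (Z₂^ n) 0ℓ
  Basis x = ∃[ i ] x ≡ e i

  𝟘≢e : {n : ℕ} (i : Fin n) → ¬ (𝟘 ≡ e i)
  𝟘≢e zero    ()
  𝟘≢e (suc i) eq = 𝟘≢e i (cong tail eq)

  lift : {n : ℕ} {x : Z₂^ n} → x ∈ ⟨ Basis ⟩ → (false ∷ x) ∈ ⟨ Basis ⟩
  lift (gen (i , refl)) = gen (suc i , refl)
  lift nil              = nil
  lift (add p q)        = add (lift p) (lift q)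

  spans : {n : ℕ} (x : Z₂^ n) → x ∈ ⟨ Basis ⟩
  spans []          = nil
  spans (false ∷ x) = lift (spans x)
  spans (true ∷ x)  = subst (λ y → (true ∷ y) ∈ ⟨ Basis ⟩) (⊕-identityˡ x)
                        (add (gen (zero , refl)) (lift (spans x)))

Q : ℕ → Graph
Q k = Cay k (standardBasis k)

-- The least k is again a relation (single-valued by IsLeast-unique): idim is
-- undefined for graphs that embed isometrically in no hypercube.
IsKmin : FiniteConnectedGraph → ℕ → Set₁
IsKmin G = IsLeast (λ k → Σ (GeneratingSet k) λ S → IsometricEmbedding graph (Cay k S))
  where open FiniteConnectedGraph G

IsIdim : FiniteConnectedGraph → ℕ → Set
IsIdim G = IsLeast (λ k → IsometricEmbedding graph (Q k))
  where open FiniteConnectedGraph G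

-- The centre is vertex zero.
data StarAdj {q : ℕ} : Rel (Fin (suc q)) 0ℓ where
  out : ∀ i → StarAdj zero (suc i)
  inw : ∀ i → StarAdj (suc i) zero

star : ℕ → FiniteConnectedGraph
star q = record
  { order     = suc q
  ; Adj       = StarAdj
  ; adj?      = λ { zero    zero    → no λ ()
                  ; zero    (suc j) → yes (out j)
                  ; (suc i) zero    → yes (inw i)
                  ; (suc i) (suc j) → no λ ()
                  }
  ; symm      = λ { (out i) → inw i ; (inw i) → out i }
  ; irrefl    = λ ()
  ; connected = λ { zero    zero    → 0 , stop
                  ; zero    (suc j) → 1 , step (out j) stop
                  ; (suc i) zero    → 1 , step (inw i) stop
                  ; (suc i) (suc j) → 2 , step (inw i) (step (out j) stop)
                  }
  }

{-# OPTIONS --safe #-}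

-- An isometric copy of K_{1,q} is a centre joined to q distinct, pairwise
-- non-adjacent leaves. In a Cayley graph on Z₂^k an independent set and its
-- translate by a generator are disjoint, so 2q ≤ 2^k. Conversely, take
-- S = {x : x₀ = 1}, whose Cayley graph is complete bipartite with parts of size
-- 2^(k-1). In the hypercube the leaves are c ⊕ e_i with distinct i, so q ≤ k,
-- and c = 0 with leaves e_0, …, e_{q-1} attains this.
module Submission where

open import Defs
open import Algebra.Consequences.Propositional using (comm∧assoc⇒middleFour)
open import Data.Bool using (Bool; true; false; _xor_)
open import Data.Bool.Properties using (xor-assoc; xor-comm)
import Data.Bool.Properties as Bool
open import Data.Empty using (⊥-elim)
open import Data.Fin using (Fin; zero; suc; inject≤)
open import Data.Fin.Properties
  using (*↔×; 2↔Bool; inject≤-injective; injective⇒≤; suc-injective)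
import Data.Fin.Properties as Fin
open import Data.Nat
  using (ℕ; zero; suc; _+_; _*_; _∸_; _^_; _≤_; _<_; z≤n; s≤s
        ; NonZero; ⌊_/2⌋; ⌈_/2⌉)
open import Data.Nat.Induction using (<-rec)
open import Data.Nat.Logarithm
  using (⌈log₂_⌉; ⌈log₂⌉-mono-≤; ⌈log₂2*n⌉≡1+⌈log₂n⌉; ⌈log₂2^n⌉≡n; ⌈log₂⌈n/2⌉⌉≡⌈log₂n⌉∸1)
open import Data.Nat.Properties
  using (≤-refl; ≰⇒>; n≮n; +-comm; +-identityʳ; +-monoˡ-≤
        ; *-assoc; *-monoʳ-≤; *-monoʳ-<; ⌊n/2⌋≤⌈n/2⌉; ⌊n/2⌋+⌈n/2⌉≡n; ⌈n/2⌉<n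
        ; module ≤-Reasoning)
open import Data.Product using (_×_; ∃-syntax; Σ-syntax; _,_; proj₁; proj₂)
open import Data.Product.Function.NonDependent.Propositional using (_×-↔_)
open import Data.Vec using ([]; _∷_; head; tail)
open import Data.Vec.Properties using (∷-injectiveʳ)
open import Function using (_∘_; _↔_; mk↔ₛ′; mk⇔; Inverse; Injection; Equivalence; Injective)
open import Function.Properties.Inverse using (↔-sym; ↔-trans; Inverse⇒Injection)
open import Relation.Binary.PropositionalEquality
  using (_≡_; _≢_; refl; sym; trans; cong; cong₂; subst; module ≡-Reasoning)
open import Relation.Nullary using (¬_; yes; no)
open import Relation.Unary using (_∈_)
open FiniteConnectedGraph using (order; graph)

-- Powers of two and the ceiling logarithm

↔-injective : {A B : Set} (f : A ↔ B) → Injective _≡_ _≡_ (Inverse.to f)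
↔-injective f = Injection.injective (Inverse⇒Injection f)

n≤2*⌈n/2⌉ : ∀ n → n ≤ 2 * ⌈ n /2⌉
n≤2*⌈n/2⌉ n = begin
  n                     ≡⟨ ⌊n/2⌋+⌈n/2⌉≡n n ⟨
  ⌊ n /2⌋ + ⌈ n /2⌉     ≤⟨ +-monoˡ-≤ ⌈ n /2⌉ (⌊n/2⌋≤⌈n/2⌉ n) ⟩
  ⌈ n /2⌉ + ⌈ n /2⌉     ≡⟨ cong (⌈ n /2⌉ +_) (+-identityʳ ⌈ n /2⌉) ⟨
  2 * ⌈ n /2⌉           ∎
  where open ≤-Reasoning

-- Strong induction by halving: for `n` at least 2, passing to `⌈ n /2⌉` lowers the ceiling
-- logarithm by one.
n≤2^⌈log₂n⌉ : ∀ n → n ≤ 2 ^ ⌈log₂ n ⌉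
n≤2^⌈log₂n⌉ = <-rec _ go
  where
  open ≤-Reasoning

  go : ∀ n → (∀ {m} → m < n → m ≤ 2 ^ ⌈log₂ m ⌉) → n ≤ 2 ^ ⌈log₂ n ⌉
  go 0 _ = z≤n
  go 1 _ = ≤-refl
  go n@(suc (suc n-2)) ih = begin
    n                             ≤⟨ n≤2*⌈n/2⌉ n ⟩
    2 * ⌈ n /2⌉                   ≤⟨ *-monoʳ-≤ 2 (ih (⌈n/2⌉<n n-2)) ⟩
    -- For `n` of the form `suc (suc _)` the logarithm computes to a successor, so the `∸ 1` cancels
    -- against `suc`.
    2 ^ suc ⌈log₂ ⌈ n /2⌉ ⌉       ≡⟨ cong (λ m → 2 ^ suc m) (⌈log₂⌈n/2⌉⌉≡⌈log₂n⌉∸1 n) ⟩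
    2 ^ ⌈log₂ n ⌉                 ∎

2*n≤2^k⇒⌈log₂n⌉<k : ∀ n {k} .{{_ : NonZero n}} → 2 * n ≤ 2 ^ k → ⌈log₂ n ⌉ < k
2*n≤2^k⇒⌈log₂n⌉<k n {k} 2n≤2^k = begin
  suc ⌈log₂ n ⌉       ≡⟨ ⌈log₂2*n⌉≡1+⌈log₂n⌉ n ⟨
  ⌈log₂ (2 * n) ⌉     ≤⟨ ⌈log₂⌉-mono-≤ 2n≤2^k ⟩
  ⌈log₂ (2 ^ k) ⌉     ≡⟨ ⌈log₂2^n⌉≡n k ⟩
  k                   ∎
  where open ≤-Reasoning

-- If it failed, the previous bound at `k = ⌈log₂ n ⌉` would give `k < k`.
2^⌈log₂n⌉<2*n : ∀ n .{{_ : NonZero n}} → 2 ^ ⌈log₂ n ⌉ < 2 * n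
2^⌈log₂n⌉<2*n n = ≰⇒> λ le → n≮n _ (2*n≤2^k⇒⌈log₂n⌉<k n le)

Z₂^↔Fin : ∀ k → Z₂^ k ↔ Fin (2 ^ k)
Z₂^↔Fin zero    = mk↔ₛ′ (λ _ → zero) (λ _ → []) (λ { zero → refl }) (λ { [] → refl })
Z₂^↔Fin (suc k) =
  ↔-trans (mk↔ₛ′ (λ x → head x , tail x) (λ (b , x) → b ∷ x) (λ _ → refl) (λ { (_ ∷ _) → refl }))
  (↔-trans (↔-sym 2↔Bool ×-↔ Z₂^↔Fin k) (↔-sym *↔×))

⊕-cancelʳ : ∀ {k} (s : Z₂^ k) {x y} → x ⊕ s ≡ y ⊕ s → x ≡ y
⊕-cancelʳ s {x} {y} eq = trans (sym (undo x)) (trans (cong (_⊕ s) eq) (undo y))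
  where
  undo : ∀ z → (z ⊕ s) ⊕ s ≡ z
  undo z = trans (⊕-assoc z s s) (trans (cong (z ⊕_) (⊕-same s)) (⊕-identityʳ z))

-- Distances up to 2 and isometric copies of stars

module _ (G : Graph) where
  open Graph G

  dist-refl : ∀ {v} → IsDist G v v 0
  dist-refl = stop , λ _ _ → z≤n

  adj⇒dist₁ : ∀ {u v} → Adj u v → IsDist G u v 1
  adj⇒dist₁ uv = step uv stop , λ where
    zero    stop → ⊥-elim (irrefl uv)
    (suc _) _    → s≤s z≤n

  dist₁⇒adj : ∀ {u v} → IsDist G u v 1 → Adj u v
  dist₁⇒adj (step uv stop , _) = uv

  path⇒dist₂ : ∀ {u v w} → Adj u v → Adj v w → u ≢ w → ¬ Adj u w → IsDist G u w 2
  path⇒dist₂ uv vw u≢w ¬uw = step uv (step vw stop) , λ where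
    zero          stop           → ⊥-elim (u≢w refl)
    (suc zero)    (step uw stop) → ⊥-elim (¬uw uw)
    (suc (suc _)) _              → s≤s (s≤s z≤n)

  dist₂⇒≢ : ∀ {u v} → IsDist G u v 2 → u ≢ v
  dist₂⇒≢ (_ , least) refl with () ← least 0 stop

  dist₂⇒¬adj : ∀ {u v} → IsDist G u v 2 → ¬ Adj u v
  dist₂⇒¬adj (_ , least) uv with s≤s () ← least 1 (step uv stop)

-- A distance is unique, so one common value per pair of vertices yields both directions of the
-- equivalence.
equal-distances⇒isometric : ∀ {G H} (φ : Graph.Vertex G → Graph.Vertex H) →
  (∀ u v → ∃[ d ] (IsDist G u v d × IsDist H (φ u) (φ v) d)) → IsometricEmbedding G H
equal-distances⇒isometric {G} {H} φ same = record
  { map       = φ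
  ; preserves = λ u v d → let d₀ , inG , inH = same u v in mk⇔
      (λ p → subst (IsDist H (φ u) (φ v)) (IsLeast-unique inG p) inH)
      (λ p → subst (IsDist G u v) (IsLeast-unique inH p) inG)
  }

leaf-dist : ∀ {q} {i j : Fin q} → i ≢ j → IsDist (graph (star q)) (suc i) (suc j) 2
leaf-dist {q} {i} {j} i≢j =
  path⇒dist₂ (graph (star q)) (inw i) (out j) (i≢j ∘ suc-injective) λ ()

-- Distances in a star are at most 2, so isometry reduces to these conditions: two vertices with a
-- common neighbour are at distance 2 exactly when they are distinct and non-adjacent.
record InducedStar (H : Graph) (q : ℕ) : Set where
  open Graph H
  field
    centre      : Vertex
    leaf        : Fin q → Vertex
    spoke       : ∀ i → Adj centre (leaf i)
    injective   : Injective _≡_ _≡_ leaf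
    independent : ∀ i j → ¬ Adj (leaf i) (leaf j)

induced⇒isometric : ∀ {H q} → InducedStar H q → IsometricEmbedding (graph (star q)) H
induced⇒isometric {H} {q} K = equal-distances⇒isometric φ same
  where
  open InducedStar K
  G = graph (star q)

  φ : Fin (suc q) → Graph.Vertex H
  φ zero    = centre
  φ (suc i) = leaf i

  same : ∀ u v → ∃[ d ] (IsDist G u v d × IsDist H (φ u) (φ v) d)
  same zero    zero    = 0 , dist-refl G , dist-refl H
  same zero    (suc j) = 1 , adj⇒dist₁ G (out j) , adj⇒dist₁ H (spoke j)
  same (suc i) zero    = 1 , adj⇒dist₁ G (inw i) , adj⇒dist₁ H (Graph.symm H (spoke i))
  same (suc i) (suc j) with i Fin.≟ j
  ... | yes refl = 0 , dist-refl G , dist-refl H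
  ... | no i≢j   = 2 , leaf-dist i≢j ,
    path⇒dist₂ H (Graph.symm H (spoke i)) (spoke j) (i≢j ∘ injective) (independent i j)

isometric⇒induced : ∀ {H q} → IsometricEmbedding (graph (star q)) H → InducedStar H q
isometric⇒induced {H} {q} E = record
  { centre      = map zero
  ; leaf        = map ∘ suc
  ; spoke       = λ i → dist₁⇒adj H (keep (adj⇒dist₁ (graph (star q)) (out i)))
  ; injective   = inj
  ; independent = indep
  }
  where
  open IsometricEmbedding E

  keep : ∀ {u v d} → IsDist (graph (star q)) u v d → IsDist H (map u) (map v) d
  keep = Equivalence.to (preserves _ _ _)

  inj : Injective _≡_ _≡_ (map ∘ suc)
  inj {i} {j} eq with i Fin.≟ j
  ... | yes i≡j = i≡j
  ... | no i≢j  = ⊥-elim (dist₂⇒≢ H (keep (leaf-dist i≢j)) eq)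

  indep : ∀ i j → ¬ Graph.Adj H (map (suc i)) (map (suc j))
  indep i j with i Fin.≟ j
  ... | yes refl = Graph.irrefl H
  ... | no i≢j   = dist₂⇒¬adj H (keep (leaf-dist i≢j))

-- Independent sets and stars in Cayley graphs

module _ {k : ℕ} (S : GeneratingSet k) where
  open GeneratingSet S

  -- A coincidence `v i ≡ v j ⊕ s` is itself an edge from `v j` to `v i`, so the set and its
  -- translate together have `2 * q` distinct points.
  independent-set-bound : ∀ {q s} (v : Fin q → Z₂^ k) → s ∈ member → Injective _≡_ _≡_ v →
    (∀ i j → ¬ Graph.Adj (Cay k S) (v i) (v j)) → 2 * q ≤ 2 ^ k
  independent-set-bound {q} {s} v s∈ v-inj indep =
    injective⇒≤ {f = Inverse.to (Z₂^↔Fin k) ∘ point ∘ Inverse.to split}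
      (↔-injective split ∘ point-injective ∘ ↔-injective (Z₂^↔Fin k))
    where
    split : Fin (2 * q) ↔ (Fin 2 × Fin q)
    split = *↔×

    point : Fin 2 × Fin q → Z₂^ k
    point (zero     , i) = v i
    point (suc zero , i) = v i ⊕ s

    point-injective : Injective _≡_ _≡_ point
    point-injective {zero     , i} {zero     , j} eq = cong (zero ,_) (v-inj eq)
    point-injective {zero     , i} {suc zero , j} eq = ⊥-elim (indep j i (s , s∈ , eq))
    point-injective {suc zero , i} {zero     , j} eq = ⊥-elim (indep i j (s , s∈ , sym eq))
    point-injective {suc zero , i} {suc zero , j} eq =
      cong (suc zero ,_) (v-inj (⊕-cancelʳ s eq))

  -- A character that is true on all of S makes the Cayley graph bipartite.
  bipartite-star : ∀ {q} (χ : Z₂^ k → Bool) → (∀ x y → χ (x ⊕ y) ≡ χ x xor χ y) →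
    (∀ {s} → s ∈ member → χ s ≡ true) →
    (v : Fin q → Z₂^ k) → Injective _≡_ _≡_ v → (∀ i → v i ∈ member) →
    InducedStar (Cay k S) q
  bipartite-star χ χ-⊕ χ-S v v-inj v∈ = record
    { centre      = 𝟘
    ; leaf        = v
    ; spoke       = λ i → v i , v∈ i , sym (⊕-identityˡ (v i))
    ; injective   = v-inj
    ; independent = λ i j (s , s∈ , eq) → true≢false (begin
        true               ≡⟨ χ-S (v∈ j) ⟨
        χ (v j)            ≡⟨ cong χ eq ⟩
        χ (v i ⊕ s)        ≡⟨ χ-⊕ (v i) s ⟩
        χ (v i) xor χ s    ≡⟨ cong₂ _xor_ (χ-S (v∈ i)) (χ-S s∈) ⟩
        false              ∎)
    }
    where
    open ≡-Reasoning

    true≢false : true ≢ false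
    true≢false ()

-- The value of k_min for stars

oddHead : ∀ m → GeneratingSet (suc m)
oddHead m = record
  { member    = λ x → head x ≡ true
  ; member?   = λ x → head x Bool.≟ true
  ; 0∉        = λ ()
  ; generates = λ where
      (true  ∷ x) → gen refl
      -- Two generators sum to it: `true ∷ 𝟘` and `true ∷ x`.
      (false ∷ x) → subst (λ y → ⟨ _ ⟩ (false ∷ y)) (⊕-identityˡ x)
                      (add (gen {s = true ∷ 𝟘} refl) (gen {s = true ∷ x} refl))
  }

kmin-star : ∀ q → 2 ≤ q → IsKmin (star q) (suc ⌈log₂ q ⌉)
kmin-star q@(suc _) _ = (oddHead m , induced⇒isometric inOddHead) , lower
  where
  m = ⌈log₂ q ⌉

  code : Fin q → Z₂^ m
  code i = Inverse.from (Z₂^↔Fin m) (inject≤ i (n≤2^⌈log₂n⌉ q))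

  code-injective : Injective _≡_ _≡_ code
  code-injective = inject≤-injective _ _ _ _ ∘ ↔-injective (↔-sym (Z₂^↔Fin m))

  inOddHead : InducedStar (Cay (suc m) (oddHead m)) q
  inOddHead = bipartite-star (oddHead m) head (λ { (_ ∷ _) (_ ∷ _) → refl }) (λ eq → eq)
    -- The leading `true` makes each leaf a generator; the other `m` bits only tell the leaves
    -- apart.
    (λ i → true ∷ code i) (code-injective ∘ ∷-injectiveʳ) (λ _ → refl)

  lower : ∀ k → Σ[ S ∈ GeneratingSet k ] IsometricEmbedding (graph (star q)) (Cay k S) →
          suc m ≤ k
  lower k (S , E) = 2*n≤2^k⇒⌈log₂n⌉<k q
    -- As `q` is positive there is a leaf `zero`, and its edge to the centre supplies the
    -- translating generator.
    (independent-set-bound S leaf (proj₁ (proj₂ (spoke zero))) injective independent)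
    where open InducedStar (isometric⇒induced E)

-- Parity and the isometric dimension of stars

parity : ∀ {k} → Z₂^ k → Bool
parity []      = false
parity (b ∷ x) = b xor parity x

-- Additivity makes `parity` the character that `bipartite-star` needs for the hypercube.
parity-⊕ : ∀ {k} (x y : Z₂^ k) → parity (x ⊕ y) ≡ parity x xor parity y
parity-⊕ []      []      = refl
parity-⊕ (a ∷ x) (b ∷ y) = begin
  (a xor b) xor parity (x ⊕ y)             ≡⟨ cong ((a xor b) xor_) (parity-⊕ x y) ⟩
  (a xor b) xor (parity x xor parity y)    ≡⟨ interchange a b (parity x) (parity y) ⟩
  (a xor parity x) xor (b xor parity y)    ∎
  where
  open ≡-Reasoning

  interchange : ∀ a b c d → (a xor b) xor (c xor d) ≡ (a xor c) xor (b xor d)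
  interchange = comm∧assoc⇒middleFour xor-comm xor-assoc

parity-𝟘 : ∀ k → parity (𝟘 {k}) ≡ false
parity-𝟘 zero    = refl
parity-𝟘 (suc k) = parity-𝟘 k

parity-e : ∀ {k} (i : Fin k) → parity (e i) ≡ true
parity-e {suc k} zero = cong (true xor_) (parity-𝟘 k)
parity-e (suc i)      = parity-e i

e-injective : ∀ {k} → Injective _≡_ _≡_ (e {k})
e-injective {x = zero}  {zero}  _  = refl
e-injective {x = suc i} {suc j} eq = cong suc (e-injective (∷-injectiveʳ eq))

idim-star : ∀ q → IsIdim (star q) q
idim-star q = induced⇒isometric inCube , lower
  where
  inCube : InducedStar (Q q) q
  inCube = bipartite-star (standardBasis q) parity parity-⊕ (λ { (i , refl) → parity-e i })
    e e-injective (λ i → i , refl)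

  lower : ∀ k → IsometricEmbedding (graph (star q)) (Q k) → q ≤ k
  -- A leaf is determined by the coordinate in which it differs from the centre.
  lower k E = injective⇒≤ {f = direction} λ {i} {j} eq →
    injective (trans (along i) (trans (cong (λ l → centre ⊕ e l) eq) (sym (along j))))
    where
    open InducedStar (isometric⇒induced E)

    direction : Fin q → Fin k
    direction i = proj₁ (proj₁ (proj₂ (spoke i)))

    along : ∀ i → leaf i ≡ centre ⊕ e (direction i)
    along i with s , (_ , refl) , eq ← spoke i = eq

-- The exponential gap is made quantitative: `2 ^ k` lies between `2 * d` and `4 * d`, so `d` is
-- `2 ^ k` up to a constant factor.
theorem2p37 : (∀ (q : ℕ) → 2 ≤ q → IsKmin (star q) (⌈log₂ q ⌉ + 1))
    × (order (star 4) ≡ 5 × IsKmin (star 4) 3 × 3 < 4 × 4 ≡ order (star 4) ∸ 1 × IsIdim (star 4) 4)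
    × (∀ (q : ℕ) → 2 ≤ q → ∃[ k ] ∃[ d ] (IsKmin (star q) k × IsIdim (star q) d × d ≡ order (star q) ∸ 1 × 2 * d ≤ 2 ^ k × 2 ^ k < 4 * d))
theorem2p37 =
    (λ q 2≤q → subst (IsKmin (star q)) (+-comm 1 ⌈log₂ q ⌉) (kmin-star q 2≤q))
  , (refl , kmin-star 4 (s≤s (s≤s z≤n)) , ≤-refl , refl , idim-star 4)
  , λ where
      q@(suc _) 2≤q → suc ⌈log₂ q ⌉ , q , kmin-star q 2≤q , idim-star q , refl
        -- With `d = q` and `k = suc ⌈log₂ q ⌉`, both bounds are the doubled inequalities
        -- `q ≤ 2 ^ ⌈log₂ q ⌉ < 2 * q`.
        , *-monoʳ-≤ 2 (n≤2^⌈log₂n⌉ q)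
        , subst (2 ^ suc ⌈log₂ q ⌉ <_) (sym (*-assoc 2 2 q)) (*-monoʳ-< 2 (2^⌈log₂n⌉<2*n q))
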